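{- Let $G$ be a connected graph with vertex set $\{1,\dots,n\}$, $n\ge 2$, let $\Phi=(F_1,\dots,F_n)$ be an $n$-tuple of pairwise disjoint graphs, and let $G[\Phi]$ be the generalized lexicographic product. If $\gamma(F_i)\ge 2$ for all $i$, then $\gamma(G[\Phi])=\gamma_r(G[\Phi])=\gamma_t(G[\Phi])=\gamma_{tr}(G[\Phi])=\gamma^{oc}(G[\Phi])=\gamma_t^{oc}(G[\Phi])$. If $\gamma(F_i)\ge 3$ for all $i$, then $\gamma(G[\Phi])\equiv\gamma_r(G[\Phi])\equiv\gamma_t(G[\Phi])\equiv\gamma_{tr}(G[\Phi])\equiv\gamma^{oc}(G[\Phi])\equiv\gamma_t^{oc}(G[\Phi])$.
   Context: All graphs are finite, simple and undirected. The generalized lexicographic product $G[\Phi]$ is the graph with vertex set $\bigcup_{i=1}^n V(F_i)$ in which each $F_i$ is an induced subgraph, and for $x\in V(F_i)$, $y\in V(F_j)$ with $i\neq j$, $xy$ is an edge iff $ij\in E(G)$. For a graph $H$ and $S\subseteq V(H)$: $S$ is dominating if every vertex outside $S$ has a neighbor in $S$; total dominating if every vertex of $H$ has a neighbor in $S$; a dominating set $S$ is restrained if every vertex outside $S$ has a neighbor outside $S$, and outer-connected if the subgraph induced by $V(H)\setminus S$ is connected. $\gamma,\gamma_t,\gamma_r,\gamma_{tr},\gamma^{oc},\gamma_t^{oc}$ denote the minimum cardinalities of, respectively, dominating, total dominating, restrained dominating, total restrained dominating (total and restrained), outer-connected dominating, and total outer-connected dominating (total and outer-connected) sets; a $\nu$-set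 is a set of the type corresponding to $\nu$ of cardinality $\nu(H)$. We write $\mu(H)\equiv\nu(H)$ (strongly equal) if the set of all $\mu$-sets of $H$ coincides with the set of all $\nu$-sets of $H$. -}

module Defs where

open import Data.Nat using (ℕ; zero; suc; _≤_)
open import Data.Bool using (Bool; true; false)
open import Data.Fin using (Fin)
open import Data.List using (List; []; _∷_; concatMap; map; allFin)
open import Data.Product using (Σ; _×_; _,_; ∃)
open import Relation.Binary.PropositionalEquality using (_≡_; _≢_)
open import Relation.Binary.Construct.Closure.ReflexiveTransitive using (Star)
open import Function.Bundles using (_⇔_)

record Graph (m : ℕ) : Set where
  field
    adj    : Fin m → Fin m → Bool
    sym    : ∀ x y → adj x y ≡ adj y x
    irrefl : ∀ x → adj x x ≡ false

Adj : ∀ {m} → Graph m → Fin m → Fin m → Set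
Adj H x y = Graph.adj H x y ≡ true

Connected : ∀ {m} → Graph m → Set
Connected H = ∀ x y → Star (Adj H) x y

-- A graph presented by a vertex type, an adjacency relation and the
-- (duplicate-free, complete) list of its vertices.
record FinGraph : Set₁ where
  field
    Vtx   : Set
    E     : Vtx → Vtx → Set
    verts : List Vtx

open FinGraph public

toFinGraph : ∀ {m} → Graph m → FinGraph
toFinGraph {m} H = record { Vtx = Fin m ; E = Adj H ; verts = allFin m }

module _ {n : ℕ} (G : Graph n) (s : Fin n → ℕ) (F : (i : Fin n) → Graph (s i)) where
  LexV : Set
  LexV = Σ (Fin n) (λ i → Fin (s i))

  data LexAdj : LexV → LexV → Set where
    inside : ∀ {i x y} → Adj (F i) x y → LexAdj (i , x) (i , y)
    across : ∀ {i j x y} → i ≢ j → Adj G i j → LexAdj (i , x) (j , y)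

  lex : FinGraph
  lex = record
    { Vtx = LexV
    ; E = LexAdj
    ; verts = concatMap (λ i → map (λ x → (i , x)) (allFin (s i))) (allFin n)
    }

module _ (H : FinGraph) where
  Subset : Set
  Subset = Vtx H → Bool

  card : Subset → ℕ
  card S = go (verts H)
    where
    go : List (Vtx H) → ℕ
    go [] = 0
    go (v ∷ vs) with S v
    ... | true  = suc (go vs)
    ... | false = go vs

  In Out : Subset → Vtx H → Set
  In  S v = S v ≡ true
  Out S v = S v ≡ false

  Dominating : Subset → Set
  Dominating S = ∀ v → Out S v → ∃ λ u → In S u × E H v u

  TotalDominating : Subset → Set
  TotalDominating S = ∀ v → ∃ λ u → In S u × E H v u

  RestrainedDominating : Subset → Set
  RestrainedDominating S =
    Dominating S × (∀ v → Out S v → ∃ λ u → Out S u × E H v u)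

  TotalRestrainedDominating : Subset → Set
  TotalRestrainedDominating S =
    TotalDominating S × (∀ v → Out S v → ∃ λ u → Out S u × E H v u)

  OutStep : Subset → Vtx H → Vtx H → Set
  OutStep S a b = E H a b × Out S b

  -- V \ S induces a connected subgraph (the empty graph counts as connected)
  OuterConnected : Subset → Set
  OuterConnected S = ∀ u v → Out S u → Out S v → Star (OutStep S) u v

  OuterConnectedDominating : Subset → Set
  OuterConnectedDominating S = Dominating S × OuterConnected S

  TotalOuterConnectedDominating : Subset → Set
  TotalOuterConnectedDominating S = TotalDominating S × OuterConnected S

IsMinSet : (H : FinGraph) → (Subset H → Set) → Subset H → Set
IsMinSet H P S = P S × (∀ T → P T → card H S ≤ card H T)

HasValue : (H : FinGraph) → (Subset H → Set) → ℕ → Set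
HasValue H P k = ∃ λ S → IsMinSet H P S × card H S ≡ k

StronglyEqual : (H : FinGraph) → (Subset H → Set) → (Subset H → Set) → Set
StronglyEqual H P Q = ∀ S → IsMinSet H P S ⇔ IsMinSet H Q S

{-# OPTIONS --safe #-}
module Submission where

-- Write H = G[Φ] and D_i = D ∩ V(F_i). Let D be a dominating set of H; call i occupied when D_i
-- is nonempty, and isolated when moreover no neighbour of i in G is occupied. If i is isolated
-- then D_i dominates F_i, so ∣D_i∣ ≥ 2 pays both for i and for one neighbour of i. Hence the
-- occupied indices, together with one neighbour of each isolated index, form a total dominating
-- set of G with at most ∣D∣ elements. Conversely, picking one vertex of F_i for every i in a
-- minimum total dominating set of G gives a total dominating set of H which covers no F_i
-- completely; as G is connected, such a set is restrained and outer-connected. It is therefore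
-- a minimum set of all six types.
--
-- If γ(F_i) ≥ 3, the count above is strict as soon as some i is isolated or some F_i lies
-- inside D, so a minimum dominating set D has neither and is itself of all six types.

open import Defs
open import Data.Bool using (Bool; true; false; if_then_else_; _∧_)
open import Data.Bool.Properties using () renaming (_≟_ to _≟ᵇ_)
open import Data.Fin using (Fin; zero; suc; punchIn; _≟_)
open import Data.Fin.Properties using (any?; all?; punchInᵢ≢i)
open import Data.Fin.Subset.Properties using (anySubset?)
open import Data.List using (List; []; _∷_; _++_; map; tabulate; concatMap; allFin)
open import Data.List.Properties using (map-tabulate)
open import Data.Nat using (ℕ; zero; suc; _+_; _*_; _≤_; _<_; z≤n; s≤s; _<?_)
open import Data.Nat.Properties hiding (_≟_)
open import Data.Product using (_×_; ∃; _,_; proj₁; proj₂)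
open import Data.Sum using (_⊎_; inj₁; inj₂)
open import Data.Vec using (lookup) renaming (tabulate to tabulateᵛ)
open import Data.Vec.Properties using (lookup∘tabulate)
open import Function using (_∘_; id; mk⇔)
open import Relation.Binary.Construct.Closure.ReflexiveTransitive using (Star; ε; _◅_)
open import Relation.Binary.PropositionalEquality
open import Relation.Nullary using (¬_; Dec; yes; no; does; contradiction)
open import Relation.Nullary.Decidable using (_×-dec_; _⊎-dec_; _→-dec_; ¬?; dec-true)

open import Algebra.Properties.CommutativeMonoid.Sum +-0-commutativeMonoid
  using (sum; sum-cong-≗; ∑-distrib-+; ∑-comm; sum-replicate-zero)

-- Sums and indicators

sum-mono-≤ : ∀ {n} {f g : Fin n → ℕ} → (∀ i → f i ≤ g i) → sum f ≤ sum g
sum-mono-≤ {zero}  f≤g = z≤n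
sum-mono-≤ {suc n} f≤g = +-mono-≤ (f≤g zero) (sum-mono-≤ (f≤g ∘ suc))

term≤sum : ∀ {n} (f : Fin n → ℕ) i → f i ≤ sum f
term≤sum f zero    = m≤m+n _ _
term≤sum f (suc i) = ≤-trans (term≤sum (f ∘ suc) i) (m≤n+m _ _)

-- A termwise bound with no slack in the total has no slack in any term: bounding all other terms by
-- `f≤g` and cancelling them leaves term `i`. It later localises equality of cardinalities to single
-- fibres.
sum-≤-rigid : ∀ {n} {f g : Fin n → ℕ} → (∀ i → f i ≤ g i) → sum g ≤ sum f → ∀ i → g i ≤ f i
sum-≤-rigid {suc n} {f} {g} f≤g ∑g≤∑f zero =
  +-cancelʳ-≤ (sum (f ∘ suc)) _ _
    (≤-trans (+-monoʳ-≤ (g zero) (sum-mono-≤ (f≤g ∘ suc))) ∑g≤∑f)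
sum-≤-rigid {suc n} {f} {g} f≤g ∑g≤∑f (suc i) =
  sum-≤-rigid (f≤g ∘ suc)
    (+-cancelˡ-≤ (f zero) _ _ (≤-trans (+-monoˡ-≤ (sum (g ∘ suc)) (f≤g zero)) ∑g≤∑f)) i

bit : Bool → ℕ
bit b = if b then 1 else 0

bit≤1 : ∀ b → bit b ≤ 1
bit≤1 true  = ≤-refl
bit≤1 false = z≤n

1≤bit : ∀ {b} → b ≡ true → 1 ≤ bit b
1≤bit refl = ≤-refl

𝟙 : ∀ {P : Set} → Dec P → ℕ
𝟙 P? = bit (does P?)

𝟙≤ : ∀ {P : Set} (P? : Dec P) {n} → (P → 1 ≤ n) → 𝟙 P? ≤ n
𝟙≤ (yes p) h = h p
𝟙≤ (no _)  h = z≤n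

1≤𝟙 : ∀ {P : Set} (P? : Dec P) → P → 1 ≤ 𝟙 P?
1≤𝟙 P? p = 1≤bit (dec-true P? p)

sum-𝟙-≟ : ∀ {n} (k : Fin n) → sum (λ i → 𝟙 (k ≟ i)) ≡ 1
sum-𝟙-≟ {suc n} zero    = cong suc (sum-replicate-zero n)
sum-𝟙-≟ {suc n} (suc k) = sum-𝟙-≟ k

size : ∀ {m} → (Fin m → Bool) → ℕ
size S = sum (bit ∘ S)

-- Cardinalities as sums

-- The solution of this metavariable is the list traversal local to card, which has no
-- name of its own.
mutual
  count : (H : FinGraph) (S : Subset H) → List (Vtx H) → ℕ
  count H S vs = _

  card≡count : (H : FinGraph) (S : Subset H) → card H S ≡ count H S (verts H)
  -- With `verts H` generalised to a variable, `refl` determines the metavariable as a function of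
  -- an arbitrary list.
  card≡count H S with verts H
  ... | vs = refl

module _ (H : FinGraph) (S : Subset H) where

  count-∷ : ∀ v vs → count H S (v ∷ vs) ≡ bit (S v) + count H S vs
  count-∷ v vs with S v
  ... | true  = refl
  ... | false = refl

  count-++ : ∀ us vs → count H S (us ++ vs) ≡ count H S us + count H S vs
  count-++ []       vs = refl
  count-++ (u ∷ us) vs
    rewrite count-∷ u (us ++ vs) | count-∷ u us | count-++ us vs = sym (+-assoc (bit (S u)) _ _)

  count-tabulate : ∀ {m} (f : Fin m → Vtx H) → count H S (tabulate f) ≡ size (S ∘ f)
  count-tabulate {zero}  f = refl
  count-tabulate {suc m} f =
    trans (count-∷ (f zero) _) (cong (bit (S (f zero)) +_) (count-tabulate (f ∘ suc)))

  count-concatMap : ∀ {m} {A : Set} (f : A → List (Vtx H)) (g : Fin m → A) →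
    count H S (concatMap f (tabulate g)) ≡ sum (λ i → count H S (f (g i)))
  count-concatMap {zero}  f g = refl
  count-concatMap {suc m} f g =
    trans (count-++ (f (g zero)) _) (cong (count H S (f (g zero)) +_) (count-concatMap f (g ∘ suc)))

card≡size : ∀ {m} (H : Graph m) S → card (toFinGraph H) S ≡ size S
card≡size H S = trans (card≡count (toFinGraph H) S) (count-tabulate (toFinGraph H) S id)

card-lex : ∀ {n} (G : Graph n) s F S →
  card (lex G s F) S ≡ sum (λ i → size (λ x → S (i , x)))
card-lex {n} G s F S = begin
  card H S                                         ≡⟨ card≡count H S ⟩
  count H S (concatMap fibre (allFin n))           ≡⟨ count-concatMap H S fibre id ⟩
  sum (λ i → count H S (fibre i))                  ≡⟨ sum-cong-≗ (λ i → cong (count H S) (map-tabulate id (i ,_))) ⟩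
  sum (λ i → count H S (tabulate (λ x → i , x)))   ≡⟨ sum-cong-≗ (λ i → count-tabulate H S (i ,_)) ⟩
  sum (λ i → size (λ x → S (i , x)))               ∎
  where
  open ≡-Reasoning
  H = lex G s F
  fibre : Fin n → List (Vtx H)
  fibre i = map (i ,_) (allFin (s i))

-- Minimum sets

module _ {m} (H : Graph m) {P : Subset (toFinGraph H) → Set}
         (P? : ∀ S → Dec (P S)) (P-resp : ∀ {S T} → S ≗ T → P S → P T) where

  size-lookup∘tabulate : (S : Fin m → Bool) → size (lookup (tabulateᵛ S)) ≡ size S
  size-lookup∘tabulate S = sum-cong-≗ (cong bit ∘ lookup∘tabulate S)

  -- Passes to a strictly smaller set with `P` until there is none; `k` strictly bounds the size and
  -- so the number of rounds.
  descend : ∀ k S → size S < k → P S → ∃ λ T → P T × (∀ U → P U → size T ≤ size U)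
  descend (suc k) S (s≤s S≤k) p
    with anySubset? (λ v → P? (lookup v) ×-dec (size (lookup v) <? size S))
  ... | yes (v , pv , v<S) = descend k (lookup v) (≤-trans v<S S≤k) pv
  -- The search ranges over Boolean vectors; `U` agrees with its tabulation only pointwise, hence
  -- `P-resp`.
  ... | no ∄smaller = S , p , λ U pU → ≮⇒≥ λ U<S → ∄smaller
    ( tabulateᵛ U
    , P-resp (sym ∘ lookup∘tabulate U) pU
    , subst (_< size S) (sym (size-lookup∘tabulate U)) U<S)

  minimum : ∀ S → P S → ∃ λ T → P T × (∀ U → P U → size T ≤ size U)
  minimum S = descend (suc (size S)) S ≤-refl

module _ {m} (H : Graph m) where
  private FG = toFinGraph H

  adj? : ∀ x y → Dec (Adj H x y)
  adj? x y = Graph.adj H x y ≟ᵇ true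

  hasNeighbourIn? : ∀ (S : Subset FG) v → Dec (∃ λ u → In FG S u × E FG v u)
  hasNeighbourIn? S v = any? λ u → (S u ≟ᵇ true) ×-dec adj? v u

  dominating? : ∀ S → Dec (Dominating FG S)
  dominating? S = all? λ v → (S v ≟ᵇ false) →-dec hasNeighbourIn? S v

  totalDominating? : ∀ S → Dec (TotalDominating FG S)
  totalDominating? S = all? (hasNeighbourIn? S)

  totalDominating-resp : ∀ {S T} → S ≗ T → TotalDominating FG S → TotalDominating FG T
  totalDominating-resp S≗T td v =
    let u , u∈S , vu = td v in u , trans (sym (S≗T u)) u∈S , vu

  dominating-resp : ∀ {S T} → S ≗ T → Dominating FG S → Dominating FG T
  dominating-resp S≗T dom v v∉T =
    let u , u∈S , vu = dom v (trans (S≗T v) v∉T) in u , trans (sym (S≗T u)) u∈S , vu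

  -- The hypothesis speaks only of attained minima, so a minimum dominating set has to be exhibited
  -- before it bounds `size S`.
  γ-bound⇒size-bound : ∀ {r} → (∀ k → HasValue FG (Dominating FG) k → r ≤ k) →
    ∀ S → Dominating FG S → r ≤ size S
  γ-bound⇒size-bound r≤γ S dom with minimum H dominating? dominating-resp S dom
  ... | T , domT , minT = ≤-trans
    (r≤γ (size T)
      ( T
      , (domT , λ U domU → subst₂ _≤_ (sym (card≡size H T)) (sym (card≡size H U)) (minT U domU))
      , card≡size H T))
    (minT S dom)

  -- A set that misses no vertex dominates vacuously; thus a fibre lying wholly inside a set is
  -- subject to the bound on γ of that fibre.
  out-vertex-or-dominating : ∀ (S : Subset FG) → (∃ λ x → Out FG S x) ⊎ Dominating FG S
  out-vertex-or-dominating S with any? (λ x → S x ≟ᵇ false)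
  ... | yes x∉S = inj₁ x∉S
  ... | no  ∄x  = inj₂ λ x x∉S → contradiction (x , x∉S) ∄x

-- In the graph without vertices the empty set dominates and has size 0.
size-bound⇒vertex : ∀ {m} (H : Graph m) →
  (∀ S → Dominating (toFinGraph H) S → 1 ≤ size S) → Fin m
size-bound⇒vertex {zero}  H bound = contradiction (bound (λ ()) λ ()) λ ()
size-bound⇒vertex {suc m} H bound = zero

Adj⇒≢ : ∀ {m} (H : Graph m) {x y} → Adj H x y → x ≢ y
Adj⇒≢ H {x} xy refl = contradiction (trans (sym xy) (Graph.irrefl H x)) λ ()

-- The first edge of a walk from `i` to some other vertex, which exists because `n` is at least 2.
neighbour : ∀ {n} (G : Graph n) → 2 ≤ n → Connected G → ∀ i → ∃ λ j → Adj G i j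
neighbour G (s≤s (s≤s _)) conn i = first (punchInᵢ≢i i zero) (conn i (punchIn i zero))
  where
  first : ∀ {i j} → j ≢ i → Star (Adj G) i j → ∃ λ k → Adj G i k
  first j≢i ε        = contradiction refl j≢i
  first j≢i (ik ◅ _) = _ , ik

-- Domination in the product

module Product {n : ℕ} (G : Graph n) (s : Fin n → ℕ) (F : (i : Fin n) → Graph (s i))
         (2≤n : 2 ≤ n) (conn : Connected G)
         (2≤γ : ∀ i S → Dominating (toFinGraph (F i)) S → 2 ≤ size S) where

  H   = lex G s F
  FG  = toFinGraph G

  nb : Fin n → Fin n
  nb i = proj₁ (neighbour G 2≤n conn i)

  nb-adj : ∀ i → Adj G i (nb i)
  nb-adj i = proj₂ (neighbour G 2≤n conn i)

  pt : ∀ i → Fin (s i)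
  pt i = size-bound⇒vertex (F i) (λ S dom → ≤-trans (s≤s z≤n) (2≤γ i S dom))

  fibre : Subset H → ∀ i → Subset (toFinGraph (F i))
  fibre S i x = S (i , x)

  step : ∀ {i j x y} → Adj G i j → LexAdj G s F (i , x) (j , y)
  step ij = across (Adj⇒≢ G ij) ij

  record AllTypes (S : Subset H) : Set where
    field
      total      : TotalDominating H S
      restrained : ∀ v → Out H S v → ∃ λ u → Out H S u × E H v u
      connected  : OuterConnected H S

    dominating : Dominating H S
    dominating v _ = total v

  open AllTypes

  -- The missing vertex over `nb i` is adjacent to the whole fibre over `i`, and a walk in `G` lifts
  -- through the missing vertices of the fibres it visits.
  missing-fibres⇒AllTypes : ∀ {S} → TotalDominating H S →
    (∀ i → ∃ λ x → Out H S (i , x)) → AllTypes S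
  missing-fibres⇒AllTypes {S} td out = record
    { total      = td
    ; restrained = λ (i , _) _ → (nb i , proj₁ (out (nb i))) , proj₂ (out (nb i)) , step (nb-adj i)
    -- The detour through `nb i` guarantees at least one edge even when `i` equals `j`, so the last
    -- step can land on the prescribed vertex.
    ; connected  = λ (i , _) (j , _) _ v∉S → walk (nb-adj i) (conn (nb i) j) v∉S
    }
    where
    walk : ∀ {i k j x y} → Adj G i k → Star (Adj G) k j → Out H S (j , y) →
      Star (OutStep H S) (i , x) (j , y)
    walk ik ε                  y∉S = (step ik , y∉S) ◅ ε
    walk {k = k} ik (kl ◅ lj) y∉S = (step ik , proj₂ (out k)) ◅ walk kl lj y∉S

  lift : Subset FG → Subset H
  lift T (i , x) = T i ∧ does (pt i ≟ x)

  size-lift : ∀ T i → size (fibre (lift T) i) ≡ bit (T i)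
  size-lift T i with T i
  ... | true  = sum-𝟙-≟ (pt i)
  ... | false = sum-replicate-zero (s i)

  lift-AllTypes : ∀ {T} → TotalDominating FG T → AllTypes (lift T)
  lift-AllTypes {T} td = missing-fibres⇒AllTypes total′ out
    where
    total′ : TotalDominating H (lift T)
    total′ (i , _) with td i
    ... | j , j∈T , ij = (j , pt j) , cong₂ _∧_ j∈T (dec-true (pt j ≟ pt j) refl) , step ij

    out : ∀ i → ∃ λ x → Out H (lift T) (i , x)
    out i with out-vertex-or-dominating (F i) (fibre (lift T) i)
    ... | inj₁ x∉S = x∉S
    -- A fibre of the lift has at most one vertex, too few to dominate `F i`.
    ... | inj₂ dom = contradiction
      (≤-trans (2≤γ i _ dom) (≤-trans (≤-reflexive (size-lift T i)) (bit≤1 (T i)))) λ { (s≤s ()) }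

  -- Projecting a dominating set of the product to `G`

  module Projection (D : Subset H) (dom : Dominating H D) where

    Occupied : Fin n → Set
    Occupied i = ∃ λ x → In H D (i , x)

    occupied? : ∀ i → Dec (Occupied i)
    occupied? i = any? λ x → D (i , x) ≟ᵇ true

    NearOccupied : Fin n → Set
    NearOccupied i = ∃ λ j → Adj G i j × Occupied j

    nearOccupied? : ∀ i → Dec (NearOccupied i)
    nearOccupied? i = any? λ j → adj? G i j ×-dec occupied? j

    Isolated : Fin n → Set
    Isolated i = Occupied i × ¬ NearOccupied i

    isolated? : ∀ i → Dec (Isolated i)
    isolated? i = occupied? i ×-dec ¬? (nearOccupied? i)

    ¬near⇒fibre-dominating : ∀ i → ¬ NearOccupied i → Dominating (toFinGraph (F i)) (fibre D i)
    ¬near⇒fibre-dominating i ¬near x x∉D with dom (i , x) x∉D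
    ... | (_ , y) , y∈D , inside xy   = y , y∈D , xy
    ... | (j , y) , y∈D , across _ ij = contradiction (j , ij , y , y∈D) ¬near

    -- Either `pt i` is in `D`, or its dominator lies in the same fibre. Hence an index without
    -- occupied neighbours is automatically isolated.
    ¬near⇒occupied : ∀ i → ¬ NearOccupied i → Occupied i
    ¬near⇒occupied i ¬near with D (i , pt i) in eq
    ... | true  = pt i , eq
    ... | false with ¬near⇒fibre-dominating i ¬near (pt i) eq
    ...   | y , y∈D , _ = y , y∈D

    Chosen : Fin n → Set
    Chosen i = Occupied i ⊎ ∃ λ j → Isolated j × nb j ≡ i

    chosen? : ∀ i → Dec (Chosen i)
    chosen? i = occupied? i ⊎-dec any? λ j → isolated? j ×-dec (nb j ≟ i)

    proj : Subset FG
    proj i = does (chosen? i)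

    proj-total : TotalDominating FG proj
    proj-total i with nearOccupied? i
    ... | yes (j , ij , occ) = j , dec-true (chosen? j) (inj₁ occ) , ij
    ... | no ¬near = nb i
      , dec-true (chosen? (nb i)) (inj₂ (i , (¬near⇒occupied i ¬near , ¬near) , refl))
      , nb-adj i

    -- What `i` pays: one for itself if occupied, and one more for `nb i` if isolated.
    weight : Fin n → ℕ
    weight i = 𝟙 (occupied? i) + 𝟙 (isolated? i)

    charge : Fin n → Fin n → ℕ
    charge i j = 𝟙 (isolated? j) * 𝟙 (nb j ≟ i)

    chosen≤ : ∀ i → bit (proj i) ≤ 𝟙 (occupied? i) + sum (charge i)
    chosen≤ i = 𝟙≤ (chosen? i) λ
      { (inj₁ occ)          → ≤-trans (1≤𝟙 (occupied? i) occ) (m≤m+n _ _)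
      ; (inj₂ (j , iso , e)) → ≤-trans (*-mono-≤ (1≤𝟙 (isolated? j) iso) (1≤𝟙 (nb j ≟ i) e))
                                (≤-trans (term≤sum (charge i) j) (m≤n+m _ _)) }

    sum-charge : ∀ j → sum (λ i → charge i j) ≡ 𝟙 (isolated? j)
    sum-charge j with does (isolated? j)
    ... | true  = trans (sum-cong-≗ λ i → *-identityˡ (𝟙 (nb j ≟ i))) (sum-𝟙-≟ (nb j))
    ... | false = sum-replicate-zero n

    -- Double counting: the charges are collected by receiver, then regrouped by payer, and each
    -- isolated index pays exactly once.
    size-proj : size proj ≤ sum weight
    size-proj = begin
      size proj                                         ≤⟨ sum-mono-≤ chosen≤ ⟩
      sum (λ i → occ i + sum (charge i))                ≡⟨ ∑-distrib-+ occ (sum ∘ charge) ⟩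
      sum occ + sum (λ i → sum (charge i))              ≡⟨ cong (sum occ +_) (∑-comm charge) ⟩
      sum occ + sum (λ j → sum (λ i → charge i j))      ≡⟨ cong (sum occ +_) (sum-cong-≗ sum-charge) ⟩
      sum occ + sum (𝟙 ∘ isolated?)                     ≡⟨ ∑-distrib-+ occ (𝟙 ∘ isolated?) ⟨
      sum weight                                        ∎
      where
      open ≤-Reasoning
      occ = 𝟙 ∘ occupied?

    weight≤2 : ∀ i → weight i ≤ 2
    weight≤2 i = +-mono-≤ (bit≤1 (does (occupied? i))) (bit≤1 (does (isolated? i)))

    weight≤size : ∀ i → weight i ≤ size (fibre D i)
    weight≤size i = by-cases (isolated? i) (weight≤2 i)
      where
      by-cases : (d : Dec (Isolated i)) → 𝟙 (occupied? i) + 𝟙 d ≤ 2 →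
        𝟙 (occupied? i) + 𝟙 d ≤ size (fibre D i)
      -- The fibre dominates `F i`, so γ at least 2 covers both units of weight.
      by-cases (yes (_ , ¬near)) ≤2 = ≤-trans ≤2 (2≤γ i _ (¬near⇒fibre-dominating i ¬near))
      by-cases (no _) _ = ≤-trans (≤-reflexive (+-identityʳ _)) (𝟙≤ (occupied? i) λ (x , x∈D) →
        ≤-trans (1≤bit x∈D) (term≤sum (bit ∘ fibre D i) x))

    size-proj≤card : size proj ≤ card H D
    size-proj≤card = ≤-trans size-proj
      (≤-trans (sum-mono-≤ weight≤size) (≤-reflexive (sym (card-lex G s F D))))

    -- Here `size proj`, `sum weight` and `card H D` all coincide, so each fibre has exactly its
    -- weight, at most 2 vertices, and cannot dominate `F i`. This rules out full fibres and indices
    -- without occupied neighbours alike.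
    AllTypes-if-small : (∀ i S → Dominating (toFinGraph (F i)) S → 3 ≤ size S) →
      card H D ≤ size proj → AllTypes D
    AllTypes-if-small 3≤γ D≤proj = missing-fibres⇒AllTypes total′ out
      where
      ¬fibre-dominating : ∀ i → ¬ Dominating (toFinGraph (F i)) (fibre D i)
      ¬fibre-dominating i fd = 1+n≰n (≤-trans (3≤γ i _ fd) (≤-trans
        (sum-≤-rigid weight≤size
          (≤-trans (≤-reflexive (sym (card-lex G s F D))) (≤-trans D≤proj size-proj)) i)
        (weight≤2 i)))

      out : ∀ i → ∃ λ x → Out H D (i , x)
      out i with out-vertex-or-dominating (F i) (fibre D i)
      ... | inj₁ x∉D = x∉D
      ... | inj₂ fd  = contradiction fd (¬fibre-dominating i)

      total′ : TotalDominating H D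
      total′ (i , _) with nearOccupied? i
      ... | yes (j , ij , y , y∈D) = (j , y) , y∈D , step ij
      ... | no ¬near = contradiction (¬near⇒fibre-dominating i ¬near) (¬fibre-dominating i)

  -- A common minimum set for all six types

  minimum-total : ∃ λ T → TotalDominating FG T × (∀ U → TotalDominating FG U → size T ≤ size U)
  minimum-total = minimum G (totalDominating? G) (totalDominating-resp G)
    -- The search starts from the full vertex set.
    (λ _ → true) λ i → nb i , refl , nb-adj i

  T₀ : Subset FG
  T₀ = proj₁ minimum-total

  S₀ : Subset H
  S₀ = lift T₀

  -- Identifies the common value of the six parameters as the total domination number of `G`.
  card-S₀ : card H S₀ ≡ size T₀
  card-S₀ = trans (card-lex G s F S₀) (sum-cong-≗ (size-lift T₀))

  S₀-AllTypes : AllTypes S₀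
  S₀-AllTypes = lift-AllTypes (proj₁ (proj₂ minimum-total))

  size-T₀≤proj : ∀ D (dom : Dominating H D) → size T₀ ≤ size (Projection.proj D dom)
  size-T₀≤proj D dom = proj₂ (proj₂ minimum-total) _ (Projection.proj-total D dom)

  S₀-minimum : ∀ D → Dominating H D → card H S₀ ≤ card H D
  S₀-minimum D dom = ≤-trans (≤-reflexive card-S₀)
    (≤-trans (size-T₀≤proj D dom) (Projection.size-proj≤card D dom))

  -- All six types are sandwiched between `AllTypes` and `Dominating`, so one argument serves them
  -- all: `S₀` has the type, and it is minimum even among all dominating sets.
  Intermediate : (Subset H → Set) → Set
  Intermediate P = (∀ {S} → AllTypes S → P S) × (∀ {S} → P S → Dominating H S)

  common-value : ∀ {P} → Intermediate P → HasValue H P (card H S₀)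
  common-value (all⇒P , P⇒dom) =
    S₀ , (all⇒P S₀-AllTypes , λ T p → S₀-minimum T (P⇒dom p)) , refl

  module _ (3≤γ : ∀ i S → Dominating (toFinGraph (F i)) S → 3 ≤ size S) where

    -- Comparison with `S₀` gives `card H S` at most `size T₀`, which is at most the size of the
    -- projection of `S`; so `AllTypes-if-small` applies to `S`.
    minimum⇒minimum : ∀ {P Q} → Intermediate P → Intermediate Q →
      ∀ S → IsMinSet H P S → IsMinSet H Q S
    minimum⇒minimum (all⇒P , P⇒dom) (all⇒Q , Q⇒dom) S (p , minS) =
      all⇒Q (Projection.AllTypes-if-small S (P⇒dom p) 3≤γ
        (≤-trans S≤S₀ (≤-trans (≤-reflexive card-S₀) (size-T₀≤proj S (P⇒dom p))))) ,
      λ T q → ≤-trans S≤S₀ (S₀-minimum T (Q⇒dom q))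
      where
      S≤S₀ : card H S ≤ card H S₀
      S≤S₀ = minS S₀ (all⇒P S₀-AllTypes)

    strongly-equal : ∀ {P Q} → Intermediate P → Intermediate Q → StronglyEqual H P Q
    strongly-equal P Q S = mk⇔ (minimum⇒minimum P Q S) (minimum⇒minimum Q P S)

  γ-int : Intermediate (Dominating H)
  γ-int = dominating , id

  γᵣ-int : Intermediate (RestrainedDominating H)
  γᵣ-int = (λ a → dominating a , restrained a) , proj₁

  γₜ-int : Intermediate (TotalDominating H)
  γₜ-int = total , λ td v _ → td v

  γₜᵣ-int : Intermediate (TotalRestrainedDominating H)
  γₜᵣ-int = (λ a → total a , restrained a) , λ (td , _) v _ → td v

  γᵒᶜ-int : Intermediate (OuterConnectedDominating H)
  γᵒᶜ-int = (λ a → dominating a , connected a) , proj₁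

  γₜᵒᶜ-int : Intermediate (TotalOuterConnectedDominating H)
  γₜᵒᶜ-int = (λ a → total a , connected a) , λ (td , _) v _ → td v

theorem2p9 : ∀ {n : ℕ} (G : Graph n) (s : Fin n → ℕ) (F : (i : Fin n) → Graph (s i))
    → 2 ≤ n
    → Connected G
    → ((∀ i k → HasValue (toFinGraph (F i)) (Dominating (toFinGraph (F i))) k → 2 ≤ k)
    → ∃ λ k →
    HasValue (lex G s F) (Dominating (lex G s F)) k
    × HasValue (lex G s F) (RestrainedDominating (lex G s F)) k
    × HasValue (lex G s F) (TotalDominating (lex G s F)) k
    × HasValue (lex G s F) (TotalRestrainedDominating (lex G s F)) k
    × HasValue (lex G s F) (OuterConnectedDominating (lex G s F)) k
    × HasValue (lex G s F) (TotalOuterConnectedDominating (lex G s F)) k)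
    × ((∀ i k → HasValue (toFinGraph (F i)) (Dominating (toFinGraph (F i))) k → 3 ≤ k)
    → StronglyEqual (lex G s F) (Dominating (lex G s F)) (RestrainedDominating (lex G s F))
    × StronglyEqual (lex G s F) (RestrainedDominating (lex G s F)) (TotalDominating (lex G s F))
    × StronglyEqual (lex G s F) (TotalDominating (lex G s F)) (TotalRestrainedDominating (lex G s F))
    × StronglyEqual (lex G s F) (TotalRestrainedDominating (lex G s F)) (OuterConnectedDominating (lex G s F))
    × StronglyEqual (lex G s F) (OuterConnectedDominating (lex G s F)) (TotalOuterConnectedDominating (lex G s F)))
theorem2p9 G s F 2≤n conn =
  (λ 2≤γ →
    let open Product G s F 2≤n conn (λ i → γ-bound⇒size-bound (F i) (2≤γ i))
    in card H S₀ , common-value γ-int , common-value γᵣ-int , common-value γₜ-int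
       , common-value γₜᵣ-int , common-value γᵒᶜ-int , common-value γₜᵒᶜ-int) ,
  (λ 3≤γ →
    let 3≤size = λ i → γ-bound⇒size-bound (F i) (3≤γ i)
        open Product G s F 2≤n conn (λ i S dom → ≤-trans (n≤1+n 2) (3≤size i S dom))
    in strongly-equal 3≤size γ-int γᵣ-int , strongly-equal 3≤size γᵣ-int γₜ-int
       , strongly-equal 3≤size γₜ-int γₜᵣ-int , strongly-equal 3≤size γₜᵣ-int γᵒᶜ-int
       , strongly-equal 3≤size γᵒᶜ-int γₜᵒᶜ-int)
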